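{- Let $a=2^s$ with $s\ge1$ an integer, let $q=2^a+1$ be a Fermat prime and $p$ a prime divisor of $2^a-1$. Let $S=-S\subseteq\mathbb{Z}_p^*$ and $U\subseteq\mathbb{Z}_p$. Then the clique number of $\Gamma(a,p,S,U)$ satisfies $\omega(\Gamma(a,p,S,U))\ge p$, with equality only when $p=2^{2^l}+1$ for some $0\le l\le s-1$.
   Context: A Fermat prime is a prime of the form $2^{2^s}+1$ with $s\ge0$ an integer. $\omega$ denotes the clique number. The Marušič-Scapellato graph $\Gamma(a,p,S,U)$ is defined as follows. Let $w$ be a primitive element of $\mathrm{GF}(2^a)$. The vertex set is $(\mathrm{GF}(2^a)\cup\{\infty\})\times\mathbb{Z}_p$. The neighbourhood of $(\infty,r)$ is $\{(\infty,r+s'):s'\in S\}\cup\{(x,r+u):x\in\mathrm{GF}(2^a),u\in U\}$. The neighbourhood of $(x,r)$ with $x\in\mathrm{GF}(2^a)$ is $\{(x,r+s'):s'\in S\}\cup\{(\infty,r-u):u\in U\}\cup\{(x+w^i,-r+u+2i):i\in\mathbb{Z}_{2^a-1},u\in U\}$. $S$ may be empty.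
   Formalization: The formal theorem assumes that U is nonempty; for U empty the claim fails, e.g. a=2, p=3, S=U=∅ gives an edgeless graph with clique number 1 < 3. -}

module Defs where

open import Algebra.Bundles using (AbelianGroup; CommutativeRing; Semiring)
open import Algebra.Core using (Op₁; Op₂)
open import Algebra.Structures using (IsCommutativeRing)
import Algebra.Definitions.RawSemiring as RawSemiringDefs
import Algebra.Properties.AbelianGroup as AbelianGroupProperties
import Algebra.Properties.CommutativeMonoid.Sum as Sum
import Algebra.Properties.Semiring.Mult as Mult
open import Data.Fin.Base using (Fin; toℕ)
open import Data.Fin.Properties using (all?; any?; toℕ<n; toℕ-fromℕ<; toℕ-injective; *↔×)
import Data.Fin.Properties as Fin
open import Data.Fin.Subset using (Subset; _∈_; _∉_; ∣_∣)
open import Data.Fin.Subset.Properties using (_∈?_; anySubset?; ∣p∣≤n; ∉⊥; ∣⊥∣≡0)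
import Data.Fin.Subset as Subset
open import Data.Maybe.Base using (Maybe; just; nothing)
open import Data.Maybe.Properties using (just-injective)
import Data.Maybe.Properties as Maybe
open import Data.Nat.Base using (ℕ; zero; suc; _≤_; s≤s; NonZero; _∸_)
import Data.Nat.Base as ℕ
open import Data.Nat.DivMod
  using (_%_; _mod_; m<n⇒m%n≡m; n%n≡0; %-distribˡ-+)
open import Data.Nat.Primality using (Prime)
import Data.Nat.Properties as ℕ
open import Data.Product.Base using (∃-syntax; _×_; _,_; proj₁; proj₂)
open import Data.Product.Function.NonDependent.Propositional using (_×-↔_)
import Data.Product.Properties as Product
open import Data.Sum.Base using (_⊎_; inj₁; inj₂)
open import Function.Base using (_∘_)
open import Function.Bundles using (_↔_; _⇔_; module Inverse; module Equivalence; mk↔ₛ′)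
open import Function.Construct.Composition using (_↔-∘_)
open import Function.Construct.Symmetry using (↔-sym)
open import Function.Properties.Inverse using (↔⇒↣)
open import Level using (0ℓ)
open import Relation.Binary.Core using (Rel)
import Relation.Binary.Definitions as Binary
open import Relation.Binary.PropositionalEquality
  using (_≡_; _≢_; refl; sym; trans; cong; cong₂; subst; module ≡-Reasoning)
import Relation.Binary.PropositionalEquality.Properties as ≡
open import Relation.Nullary.Decidable
  using (Dec; yes; no; map′; via-injection; _×-dec_; _⊎-dec_; _→-dec_; ¬?)
open import Relation.Nullary.Negation using (contradiction)
open import Relation.Unary using (Pred; Decidable)

FermatPrime : Pred ℕ 0ℓ
FermatPrime q = Prime q × ∃[ s ] q ≡ 2 ℕ.^ (2 ℕ.^ s) ℕ.+ 1

module ℤmod (p : ℕ) .{{_ : NonZero p}} where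

  infixl 6 _+_ _-_
  infix  8 -_

  fromℕ : ℕ → Fin p
  fromℕ n = n mod p

  0# : Fin p
  0# = fromℕ 0

  _+_ : Op₂ (Fin p)
  r + s = fromℕ (toℕ r ℕ.+ toℕ s)

  -_ : Op₁ (Fin p)
  - r = fromℕ (p ∸ toℕ r)

  _-_ : Op₂ (Fin p)
  r - s = r + - s

  private
    toℕ-fromℕ : ∀ n → toℕ (fromℕ n) ≡ n % p
    toℕ-fromℕ n = toℕ-fromℕ< _

    fromℕ-cong : ∀ {m n} → m % p ≡ n % p → fromℕ m ≡ fromℕ n
    fromℕ-cong {m} {n} eq =
      toℕ-injective (trans (toℕ-fromℕ m) (trans eq (sym (toℕ-fromℕ n))))

    fromℕ-toℕ : ∀ r → fromℕ (toℕ r) ≡ r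
    fromℕ-toℕ r =
      toℕ-injective (trans (toℕ-fromℕ (toℕ r)) (m<n⇒m%n≡m (toℕ<n r)))

  fromℕ-homo-+ : ∀ m n → fromℕ m + fromℕ n ≡ fromℕ (m ℕ.+ n)
  fromℕ-homo-+ m n = fromℕ-cong (begin
    (toℕ (fromℕ m) ℕ.+ toℕ (fromℕ n)) % p
      ≡⟨ cong₂ (λ x y → (x ℕ.+ y) % p) (toℕ-fromℕ m) (toℕ-fromℕ n) ⟩
    (m % p ℕ.+ n % p) % p                  ≡⟨ %-distribˡ-+ m n p ⟨
    (m ℕ.+ n) % p                          ∎)
    where open ≡-Reasoning

  private
    +-comm : ∀ r s → r + s ≡ s + r
    +-comm r s = cong fromℕ (ℕ.+-comm (toℕ r) (toℕ s))

    +-assoc : ∀ r s t → (r + s) + t ≡ r + (s + t)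
    +-assoc r s t = begin
      fromℕ (toℕ r ℕ.+ toℕ s) + t                  ≡⟨ cong (r + s +_) (fromℕ-toℕ t) ⟨
      fromℕ (toℕ r ℕ.+ toℕ s) + fromℕ (toℕ t)      ≡⟨ fromℕ-homo-+ (toℕ r ℕ.+ toℕ s) (toℕ t) ⟩
      fromℕ ((toℕ r ℕ.+ toℕ s) ℕ.+ toℕ t)          ≡⟨ cong fromℕ (ℕ.+-assoc (toℕ r) (toℕ s) (toℕ t)) ⟩
      fromℕ (toℕ r ℕ.+ (toℕ s ℕ.+ toℕ t))          ≡⟨ fromℕ-homo-+ (toℕ r) (toℕ s ℕ.+ toℕ t) ⟨
      fromℕ (toℕ r) + fromℕ (toℕ s ℕ.+ toℕ t)      ≡⟨ cong (_+ (s + t)) (fromℕ-toℕ r) ⟩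
      r + (s + t)                                  ∎
      where open ≡-Reasoning

    +-identityˡ : ∀ r → 0# + r ≡ r
    +-identityˡ r = begin
      0# + r                  ≡⟨ cong (0# +_) (fromℕ-toℕ r) ⟨
      fromℕ 0 + fromℕ (toℕ r) ≡⟨ fromℕ-homo-+ 0 (toℕ r) ⟩
      fromℕ (toℕ r)           ≡⟨ fromℕ-toℕ r ⟩
      r                       ∎
      where open ≡-Reasoning

    -‿inverseˡ : ∀ r → - r + r ≡ 0#
    -‿inverseˡ r = begin
      - r + r                          ≡⟨ cong (- r +_) (fromℕ-toℕ r) ⟨
      fromℕ (p ∸ toℕ r) + fromℕ (toℕ r) ≡⟨ fromℕ-homo-+ (p ∸ toℕ r) (toℕ r) ⟩
      fromℕ (p ∸ toℕ r ℕ.+ toℕ r)      ≡⟨ cong fromℕ (ℕ.m∸n+n≡m (ℕ.<⇒≤ (toℕ<n r))) ⟩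
      fromℕ p                          ≡⟨ fromℕ-cong (trans (n%n≡0 p) (sym (m<n⇒m%n≡m (ℕ.>-nonZero⁻¹ p)))) ⟩
      fromℕ 0                          ∎
      where open ≡-Reasoning

  +-0-abelianGroup : AbelianGroup 0ℓ 0ℓ
  +-0-abelianGroup = record
    { Carrier = Fin p ; _≈_ = _≡_ ; _∙_ = _+_ ; ε = 0# ; _⁻¹ = λ r → - r
    ; isAbelianGroup = record
      { isGroup = record
        { isMonoid = record
          { isSemigroup = record
            { isMagma = record { isEquivalence = ≡.isEquivalence ; ∙-cong = cong₂ _+_ }
            ; assoc   = +-assoc
            }
          ; identity = +-identityˡ , λ r → trans (+-comm r 0#) (+-identityˡ r)
          }
        ; inverse = -‿inverseˡ , λ r → trans (+-comm r (- r)) (-‿inverseˡ r)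
        ; ⁻¹-cong = cong (λ r → - r)
        }
      ; comm = +-comm
      }
    }

record FiniteField (n : ℕ) : Set₁ where
  infixl 6 _+_
  infixl 7 _*_
  infix  8 -_
  field
    Carrier           : Set
    _+_ _*_           : Op₂ Carrier
    -_                : Op₁ Carrier
    0# 1#             : Carrier
    isCommutativeRing : IsCommutativeRing _≡_ _+_ _*_ -_ 0# 1#
    0≢1               : 0# ≢ 1#
    invertible        : ∀ x → x ≢ 0# → ∃[ y ] x * y ≡ 1#
    enum              : Carrier ↔ Fin n

  commutativeRing : CommutativeRing 0ℓ 0ℓ
  commutativeRing = record { isCommutativeRing = isCommutativeRing }

  open CommutativeRing commutativeRing public
    using ( semiring; +-commutativeMonoid; +-abelianGroup; *-assoc; *-comm
          ; *-identityˡ; zeroʳ; +-assoc; +-identityʳ; distribˡ; *-identityʳ)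
  open RawSemiringDefs (Semiring.rawSemiring semiring) public using (_^_)

  _≟_ : Binary.DecidableEquality Carrier
  _≟_ = via-injection (↔⇒↣ enum) Fin._≟_

  nonZero-* : ∀ {x y} → x ≢ 0# → x * y ≡ 0# → y ≡ 0#
  nonZero-* {x} {y} x≢0 xy≡0 with x⁻¹ , xx⁻¹≡1 ← invertible x x≢0 = begin
    y               ≡⟨ *-identityˡ y ⟨
    1# * y          ≡⟨ cong (_* y) (trans (sym xx⁻¹≡1) (*-comm x x⁻¹)) ⟩
    x⁻¹ * x * y     ≡⟨ *-assoc x⁻¹ x y ⟩
    x⁻¹ * (x * y)   ≡⟨ cong (x⁻¹ *_) xy≡0 ⟩
    x⁻¹ * 0#        ≡⟨ zeroʳ x⁻¹ ⟩
    0#              ∎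
    where open ≡-Reasoning

record IsPrimitive {n} (F : FiniteField n) (w : FiniteField.Carrier F) : Set where
  open FiniteField F
  field
    nonZero  : w ≢ 0#
    generate : ∀ x → x ≢ 0# → ∃[ k ] x ≡ w ^ k

module _ {n} (F : FiniteField n) where
  open FiniteField F
  open Mult semiring using (×1-homo-*) renaming (_×_ to _·_)
  open Sum +-commutativeMonoid using (sum; sum-permute; ∑-distrib-+; sum-replicate; sum-cong-≗)
  open AbelianGroupProperties +-abelianGroup using (identityʳ-unique)
  private module G = AbelianGroup +-abelianGroup

  -- Translation by 1 permutes the field, so summing all the elements
  -- gives Σ x ≡ Σ x + n · 1.
  order·1≡0 : n · 1# ≡ 0#
  order·1≡0 = identityʳ-unique (sum f) (n · 1#) (begin
    sum f + n · 1#                ≡⟨ cong (sum f +_) (sum-replicate n) ⟨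
    sum f + sum {n} (λ _ → 1#)    ≡⟨ ∑-distrib-+ f (λ _ → 1#) ⟨
    sum (λ i → f i + 1#)          ≡⟨ sum-cong-≗ (λ i → sym (Inverse.strictlyInverseʳ enum (f i + 1#))) ⟩
    sum (λ i → f (Inverse.to π i)) ≡⟨ sum-permute f π ⟨
    sum f                         ∎)
    where
    open ≡-Reasoning
    f : Fin n → Carrier
    f = Inverse.from enum
    shift : Carrier ↔ Carrier
    shift = mk↔ₛ′ (_+ 1#) (_+ - 1#)
      (λ x → trans (+-assoc x (- 1#) 1#) (trans (cong (x +_) (G.inverseˡ 1#)) (+-identityʳ x)))
      (λ x → trans (+-assoc x 1# (- 1#)) (trans (cong (x +_) (G.inverseʳ 1#)) (+-identityʳ x)))
    π : Fin n ↔ Fin n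
    π = (enum ↔-∘ shift) ↔-∘ ↔-sym enum

  ^-nonZero : ∀ {w} → w ≢ 0# → ∀ k → w ^ k ≢ 0#
  ^-nonZero w≢0 zero    = 0≢1 ∘ sym
  ^-nonZero w≢0 (suc k) = ^-nonZero w≢0 k ∘ nonZero-* w≢0

  -- Hence a field of 2ᵃ elements has characteristic 2.
  2^a·1≡0⇒2·1≡0 : ∀ a → (2 ℕ.^ a) · 1# ≡ 0# → 2 · 1# ≡ 0#
  2^a·1≡0⇒2·1≡0 zero    eq = contradiction (sym (trans (sym (+-identityʳ 1#)) eq)) 0≢1
  2^a·1≡0⇒2·1≡0 (suc a) eq with (2 · 1#) ≟ 0#
  ... | yes 2≡0 = 2≡0
  ... | no  2≢0 = 2^a·1≡0⇒2·1≡0 a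
    (nonZero-* 2≢0 (trans (sym (×1-homo-* 2 (2 ℕ.^ a))) eq))

module _ {a} (F : FiniteField (2 ℕ.^ a)) where
  open FiniteField F

  x+x≡0 : ∀ x → x + x ≡ 0#
  x+x≡0 x = begin
    x + x                    ≡⟨ cong₂ _+_ (*-identityʳ x) (*-identityʳ x) ⟨
    x * 1# + x * 1#          ≡⟨ distribˡ x 1# 1# ⟨
    x * (1# + 1#)            ≡⟨ cong (λ y → x * (1# + y)) (+-identityʳ 1#) ⟨
    x * (1# + (1# + 0#))     ≡⟨ cong (x *_) (2^a·1≡0⇒2·1≡0 F a (order·1≡0 F)) ⟩
    x * 0#                   ≡⟨ zeroʳ x ⟩
    0#                       ∎
    where open ≡-Reasoning

record Graph : Set₁ where
  infix 4 _~_ _~?_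
  field
    Vertex   : Set
    order    : ℕ
    enum     : Vertex ↔ Fin order
    _~_      : Rel Vertex 0ℓ
    _~?_     : Binary.Decidable _~_
    ~-sym    : Binary.Symmetric _~_
    ~-irrefl : Binary.Irreflexive _≡_ _~_

  vertex : Fin order → Vertex
  vertex = Inverse.from enum

-- The greatest k ≤ n satisfying P, and 0 if there is none.
greatest : ∀ {P : Pred ℕ 0ℓ} → Decidable P → ℕ → ℕ
greatest P? zero    = zero
greatest P? (suc n) with P? (suc n)
... | yes _ = suc n
... | no  _ = greatest P? n

greatest-satisfies : ∀ {P : Pred ℕ 0ℓ} (P? : Decidable P) → P 0 → ∀ n → P (greatest P? n)
greatest-satisfies P? P0 zero    = P0
greatest-satisfies P? P0 (suc n) with P? (suc n)
... | yes Pn = Pn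
... | no  _  = greatest-satisfies P? P0 n

≤-greatest : ∀ {P : Pred ℕ 0ℓ} (P? : Decidable P) {k} n → k ≤ n → P k → k ≤ greatest P? n
≤-greatest P? zero    k≤n Pk = k≤n
≤-greatest {P} P? (suc n) k≤n Pk with P? (suc n)
... | yes _  = k≤n
... | no ¬Pn with ℕ.m≤n⇒m<n∨m≡n k≤n
...   | inj₁ (s≤s k≤n′) = ≤-greatest P? n k≤n′ Pk
...   | inj₂ refl       = contradiction Pk ¬Pn

module _ (G : Graph) where
  open Graph G

  IsClique : Pred (Subset order) 0ℓ
  IsClique X = ∀ i j → i ∈ X → j ∈ X → i ≢ j → vertex i ~ vertex j

  HasClique : Pred ℕ 0ℓ
  HasClique k = ∃[ X ] IsClique X × ∣ X ∣ ≡ k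

  isClique? : Decidable IsClique
  isClique? X = all? λ i → all? λ j →
    i ∈? X →-dec (j ∈? X →-dec (¬? (i Fin.≟ j) →-dec (vertex i ~? vertex j)))

  hasClique? : Decidable HasClique
  hasClique? k = anySubset? λ X → isClique? X ×-dec (∣ X ∣ ℕ.≟ k)

  ω : ℕ
  ω = greatest hasClique? order

  hasClique-ω : HasClique ω
  hasClique-ω = greatest-satisfies hasClique?
    (Subset.⊥ , (λ _ _ i∈⊥ _ _ → contradiction i∈⊥ ∉⊥) , ∣⊥∣≡0 order) order

  hasClique⇒≤ω : ∀ {k} → HasClique k → k ≤ ω
  hasClique⇒≤ω h@(X , _ , refl) = ≤-greatest hasClique? order (∣p∣≤n X) h

pattern ∞     = nothing
pattern fin x = just x

module _ (a p : ℕ) .{{_ : NonZero p}} (F : FiniteField (2 ℕ.^ a)) where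
  private
    module F = FiniteField F
    module Z = ℤmod p
    module A = AbelianGroup Z.+-0-abelianGroup
    open F using () renaming (_+_ to _⊕_; _^_ to _^_)
    open Z using (_+_; -_; _-_; 0#; fromℕ)
    open AbelianGroupProperties Z.+-0-abelianGroup
      using (//-rightDividesˡ; //-rightDividesʳ; identityʳ-unique; ⁻¹-∙-comm; ⁻¹-involutive)

  MSVertex : Set
  MSVertex = Maybe F.Carrier × Fin p

  -- The exponent i ∈ ℤ/(2^a - 1) is represented by its residue; as long
  -- as p ∣ 2^a - 1, neither w ^ i nor 2i ∈ ℤ/p depends on this choice.
  MSNeighbourhood : F.Carrier → (S U : Subset p) → MSVertex → Pred MSVertex 0ℓ
  MSNeighbourhood w S U (∞ , r) v =
      (∃[ s ] s ∈ S × v ≡ (∞ , r + s))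
    ⊎ (∃[ x ] ∃[ u ] u ∈ U × v ≡ (fin x , r + u))
  MSNeighbourhood w S U (fin x , r) v =
      (∃[ s ] s ∈ S × v ≡ (fin x , r + s))
    ⊎ (∃[ u ] u ∈ U × v ≡ (∞ , r - u))
    ⊎ (∃[ i ] ∃[ u ] u ∈ U ×
         v ≡ (fin (x ⊕ w ^ toℕ {2 ℕ.^ a ∸ 1} i) , - r + u + fromℕ (2 ℕ.* toℕ i)))

  private
    _≟ᵥ_ : Binary.DecidableEquality MSVertex
    _≟ᵥ_ = Product.≡-dec (Maybe.≡-dec F._≟_) Fin._≟_

    anyField? : ∀ {P : Pred F.Carrier 0ℓ} → Decidable P → Dec (∃[ x ] P x)
    anyField? {P} P? = map′
      (λ (i , h) → Inverse.from F.enum i , h)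
      (λ (x , h) → Inverse.to F.enum x , subst P (sym (Inverse.strictlyInverseʳ F.enum x)) h)
      (any? (P? ∘ Inverse.from F.enum))

    vertexEnum : MSVertex ↔ Fin (suc (2 ℕ.^ a) ℕ.* p)
    vertexEnum = ↔-sym *↔× ↔-∘ (maybeEnum ×-↔ mk↔ₛ′ (λ r → r) (λ r → r) (λ _ → refl) (λ _ → refl))
      where
      maybeEnum : Maybe F.Carrier ↔ Fin (suc (2 ℕ.^ a))
      maybeEnum = mk↔ₛ′ to from to∘from from∘to
        where
        to : Maybe F.Carrier → Fin (suc (2 ℕ.^ a))
        to ∞       = Fin.zero
        to (fin x) = Fin.suc (Inverse.to F.enum x)
        from : Fin (suc (2 ℕ.^ a)) → Maybe F.Carrier
        from Fin.zero    = ∞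
        from (Fin.suc i) = fin (Inverse.from F.enum i)
        to∘from : ∀ i → to (from i) ≡ i
        to∘from Fin.zero    = refl
        to∘from (Fin.suc i) = cong Fin.suc (Inverse.strictlyInverseˡ F.enum i)
        from∘to : ∀ v → from (to v) ≡ v
        from∘to ∞       = refl
        from∘to (fin x) = cong just (Inverse.strictlyInverseʳ F.enum x)

    r≡r+s⇒s≡0 : ∀ r s → r ≡ r + s → s ≡ 0#
    r≡r+s⇒s≡0 r s eq = identityʳ-unique r s (sym eq)

    reflect : ∀ r u t → r ≡ - (- r + u + t) + u + t
    reflect r u t = sym (begin
      - (- r + u + t) + u + t        ≡⟨ A.assoc _ u t ⟩
      - (- r + u + t) + (u + t)      ≡⟨ cong (λ z → - z + (u + t)) (A.assoc (- r) u t) ⟩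
      - (- r + (u + t)) + (u + t)    ≡⟨ cong (_+ (u + t)) (⁻¹-∙-comm (- r) (u + t)) ⟨
      - - r - (u + t) + (u + t)      ≡⟨ //-rightDividesˡ (u + t) (- - r) ⟩
      - - r                          ≡⟨ ⁻¹-involutive r ⟩
      r                              ∎)
      where open ≡-Reasoning

    x+y+y : ∀ x y → x ≡ x ⊕ y ⊕ y
    x+y+y x y = sym (trans (F.+-assoc x y y)
      (trans (cong (x ⊕_) (x+x≡0 {a} F y)) (F.+-identityʳ x)))

  module _ {w} (w-primitive : IsPrimitive F w) (S U : Subset p)
           (S-symmetric : ∀ s → s ∈ S ⇔ - s ∈ S) (0∉S : 0# ∉ S) where

    private
      N = MSNeighbourhood w S U

      N? : Binary.Decidable N
      N? (∞ , r) v =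
        any? (λ s → (s ∈? S) ×-dec (v ≟ᵥ _))
        ⊎-dec anyField? (λ x → any? λ u → (u ∈? U) ×-dec (v ≟ᵥ _))
      N? (fin x , r) v =
        any? (λ s → (s ∈? S) ×-dec (v ≟ᵥ _))
        ⊎-dec any? (λ u → (u ∈? U) ×-dec (v ≟ᵥ _))
        ⊎-dec any? (λ i → any? λ u → (u ∈? U) ×-dec (v ≟ᵥ _))

      r≡r+s-s : ∀ r s → r ≡ r + s - s
      r≡r+s-s r s = sym (//-rightDividesʳ s r)

      N-sym : Binary.Symmetric N
      N-sym {∞ , r} (inj₁ (s , s∈S , refl)) =
        inj₁ (- s , Equivalence.to (S-symmetric s) s∈S , cong (∞ ,_) (r≡r+s-s r s))
      N-sym {∞ , r} (inj₂ (x , u , u∈U , refl)) =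
        inj₂ (inj₁ (u , u∈U , cong (∞ ,_) (r≡r+s-s r u)))
      N-sym {fin x , r} (inj₁ (s , s∈S , refl)) =
        inj₁ (- s , Equivalence.to (S-symmetric s) s∈S , cong (fin x ,_) (r≡r+s-s r s))
      N-sym {fin x , r} (inj₂ (inj₁ (u , u∈U , refl))) =
        inj₂ (x , u , u∈U , cong (fin x ,_) (sym (//-rightDividesˡ u r)))
      N-sym {fin x , r} (inj₂ (inj₂ (i , u , u∈U , refl))) =
        inj₂ (inj₂ (i , u , u∈U ,
          cong₂ (λ y t → fin y , t) (x+y+y x (w ^ toℕ i)) (reflect r u (fromℕ (2 ℕ.* toℕ i)))))

      N-irrefl : Binary.Irreflexive _≡_ N
      N-irrefl {∞ , r} refl (inj₁ (s , s∈S , eq)) =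
        0∉S (subst (_∈ S) (r≡r+s⇒s≡0 r s (cong proj₂ eq)) s∈S)
      N-irrefl {fin x , r} refl (inj₁ (s , s∈S , eq)) =
        0∉S (subst (_∈ S) (r≡r+s⇒s≡0 r s (cong proj₂ eq)) s∈S)
      N-irrefl {fin x , r} refl (inj₂ (inj₂ (i , u , _ , eq))) =
        ^-nonZero F (IsPrimitive.nonZero w-primitive) (toℕ i)
          (AbelianGroupProperties.identityʳ-unique F.+-abelianGroup x (w ^ toℕ i)
            (sym (just-injective (cong proj₁ eq))))

    Γ : Graph
    Γ = record
      { Vertex   = MSVertex
      ; order    = suc (2 ℕ.^ a) ℕ.* p
      ; enum     = vertexEnum
      ; _~_      = N
      ; _~?_     = N?
      ; ~-sym    = λ {v} {v′} → N-sym {v} {v′}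
      ; ~-irrefl = λ {v} {v′} → N-irrefl {v} {v′}
      }

-- Since 2^(2^s) − 1 is the product of the Fermat numbers 2^(2^l) + 1 with l < s,
-- the prime p divides one of them. Put m = 2^l and let t, t − u ∈ ℤ/p satisfy
-- 2t = u for some u ∈ U. Two vertices (x , t) and (y , t) are adjacent as soon as
-- x + y is a p-th power. The subfield GF(2^m) is closed under addition and its
-- non-zero elements are powers of w^M, M = (2^a − 1)/(2^m − 1), which is a multiple
-- of p. Hence GF(2^m) × {t} is a clique, and (∞ , t − u) is adjacent to all of it,
-- so that ω ≥ 2^m + 1 ≥ p.
module Submission where

open import Defs
open import Algebra.Bundles using (module AbelianGroup; module CommutativeRing)
import Algebra.Properties.AbelianGroup as AbelianGroupProperties
import Algebra.Properties.CommutativeSemiring.Exp as Exp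
import Algebra.Solver.Ring.NaturalCoefficients.Default as NaturalCoefficients
open import Data.Fin.Base using (Fin; zero; suc; toℕ; fromℕ<)
import Data.Fin.Properties as Fin
open import Data.Fin.Subset using (Subset; Nonempty; _∈_; _∉_)
import Data.Fin.Subset as Subset
open import Data.Fin.Subset.Properties using (x∈p∧x≢y⇒x∈p-y; x∈p⇒∣p-x∣<∣p∣)
open import Data.Nat.Base
  using (ℕ; zero; suc; _+_; _*_; _∸_; _^_; _≤_; _<_; _≥_; z≤n; s≤s; NonZero; >-nonZero)
open import Data.Nat.Divisibility
  using (_∣_; ∣⇒≤; ∣1⇒≡1; n∣m⇒m%n≡0; m%n≡0⇒n∣m; ∣n⇒∣m*n; ∣-trans; _∣0; *-cancelʳ-∣)
open import Data.Nat.DivMod using (_%_; _/_; m%n<n; m≡m%n+[m/n]*n; m<n⇒m%n≡m)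
open import Data.Nat.Primality using (Prime; euclidsLemma; ¬prime[1])
import Data.Nat.Properties as ℕ
open import Data.Nat.Tactic.RingSolver using (solve-∀)
open import Data.Product.Base using (_×_; ∃-syntax; _,_; proj₁; proj₂)
open import Data.Sum.Base using (inj₁; inj₂)
open import Data.Vec.Base using (tabulate)
open import Data.Vec.Properties using ([]=⇒lookup; lookup⇒[]=; lookup∘tabulate)
open import Function.Base using (_∘_)
open import Function.Bundles using (_⇔_; module Inverse)
open import Function.Definitions using (Injective)
open import Relation.Binary.PropositionalEquality
  using (_≡_; _≢_; refl; sym; trans; cong; cong₂; subst; module ≡-Reasoning)
open import Relation.Nullary.Decidable using (Dec; yes; no; does; dec-true)
open import Relation.Nullary.Negation using (contradiction)

-- Fermat numbers as factors of 2^(2^s) - 1.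

suc[2^n∸1]≡2^n : ∀ n → suc (2 ^ n ∸ 1) ≡ 2 ^ n
suc[2^n∸1]≡2^n n = ℕ.m+[n∸m]≡n (ℕ.m^n>0 2 n)

2^n∸1-nonZero : ∀ n .{{_ : NonZero n}} → NonZero (2 ^ n ∸ 1)
2^n∸1-nonZero (suc n) =
  >-nonZero (ℕ.∸-monoˡ-≤ 1 (ℕ.^-monoʳ-≤ 2 {1} {suc n} (s≤s z≤n)))

double-2^[2^n]∸1 : ∀ n → 2 ^ (2 ^ suc n) ∸ 1 ≡ (2 ^ (2 ^ n) + 1) * (2 ^ (2 ^ n) ∸ 1)
double-2^[2^n]∸1 n = begin
  2 ^ (2 * 2 ^ n) ∸ 1       ≡⟨ cong (λ e → 2 ^ e ∸ 1) (ℕ.*-comm 2 (2 ^ n)) ⟩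
  2 ^ (2 ^ n * 2) ∸ 1       ≡⟨ cong (_∸ 1) (ℕ.^-*-assoc 2 (2 ^ n) 2) ⟨
  (2 ^ (2 ^ n)) ^ 2 ∸ 1     ≡⟨ cong (λ b → b ^ 2 ∸ 1) (suc[2^n∸1]≡2^n (2 ^ n)) ⟨
  suc c ^ 2 ∸ 1             ≡⟨ square c ⟩
  (suc c + 1) * c           ≡⟨ cong (λ b → (b + 1) * c) (suc[2^n∸1]≡2^n (2 ^ n)) ⟩
  (2 ^ (2 ^ n) + 1) * c     ∎
  where
  open ≡-Reasoning
  c = 2 ^ (2 ^ n) ∸ 1
  -- The left-hand side is what `suc c ^ 2 ∸ 1` computes to. Writing 2^(2^n) as `suc c` removes the
  -- truncated subtraction, so the identity is one of semirings.
  square : ∀ c → c * 1 + c * suc (c * 1) ≡ (suc c + 1) * c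
  square = solve-∀

-- Induction on `s`: Euclid's lemma puts `p` either in the top Fermat factor or in the remaining
-- factor 2^(2^(s-1)) - 1, until that factor is 1. The cofactor `M` is the product of the numbers
-- 2^(2^k) + 1 with l ≤ k < s. It contains the one that `p` divides, hence `p ∣ M`.
prime∣2^[2^s]∸1 : ∀ {p} → Prime p → ∀ s → p ∣ 2 ^ (2 ^ s) ∸ 1 →
  ∃[ l ] ∃[ M ] l < s × p ∣ 2 ^ (2 ^ l) + 1 × p ∣ M × 2 ^ (2 ^ s) ∸ 1 ≡ M * (2 ^ (2 ^ l) ∸ 1)
prime∣2^[2^s]∸1 pp zero p∣1 = contradiction (subst Prime (∣1⇒≡1 p∣1) pp) ¬prime[1]
prime∣2^[2^s]∸1 {p} pp (suc s) p∣
  with euclidsLemma (2 ^ (2 ^ s) + 1) _ pp (subst (p ∣_) (double-2^[2^n]∸1 s) p∣)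
... | inj₁ p∣F = s , 2 ^ (2 ^ s) + 1 , ℕ.≤-refl , p∣F , p∣F , double-2^[2^n]∸1 s
... | inj₂ p∣c with l , M , l<s , p∣F , p∣M , eq ← prime∣2^[2^s]∸1 pp s p∣c =
  l , (2 ^ (2 ^ s) + 1) * M , ℕ.m<n⇒m<1+n l<s , p∣F , ∣n⇒∣m*n (2 ^ (2 ^ s) + 1) p∣M ,
  trans (double-2^[2^n]∸1 s)
    (trans (cong ((2 ^ (2 ^ s) + 1) *_) eq) (sym (ℕ.*-assoc (2 ^ (2 ^ s) + 1) M _)))

-- Lower bounds for the clique number.

-- Induction on `k`: removing `f zero` makes `X` strictly smaller, and by injectivity the other
-- values stay in it.
injective⇒≤∣p∣ : ∀ {k n} (f : Fin k → Fin n) → Injective _≡_ _≡_ f →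
  ∀ (X : Subset n) → (∀ i → f i ∈ X) → k ≤ Subset.∣ X ∣
injective⇒≤∣p∣ {zero}  f inj X f∈X = z≤n
injective⇒≤∣p∣ {suc k} f inj X f∈X = ℕ.≤-<-trans
  (injective⇒≤∣p∣ (f ∘ suc) (Fin.suc-injective ∘ inj) (X Subset.- f zero)
    λ i → x∈p∧x≢y⇒x∈p-y (f∈X (suc i)) λ eq → contradiction (inj eq) λ ())
  (x∈p⇒∣p-x∣<∣p∣ {p = X} (f∈X zero))

module _ (G : Graph) where
  open Graph G

  -- Irreflexivity of adjacency makes the family injective, so its image `X` is a clique with at
  -- least `k` elements.
  pairwiseAdjacent⇒≤ω : ∀ {k} (f : Fin k → Vertex) → (∀ i j → i ≢ j → f i ~ f j) → k ≤ ω G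
  pairwiseAdjacent⇒≤ω {k} f adjacent =
    ℕ.≤-trans (injective⇒≤∣p∣ g g-injective X g∈X) (hasClique⇒≤ω G (X , clique , refl))
    where
    g : Fin k → Fin order
    g = Inverse.to enum ∘ f

    vertex∘g : ∀ i → vertex (g i) ≡ f i
    vertex∘g i = Inverse.strictlyInverseʳ enum (f i)

    g-injective : Injective _≡_ _≡_ g
    g-injective {i} {j} eq with i Fin.≟ j
    ... | yes i≡j = i≡j
    ... | no  i≢j = contradiction (adjacent i j i≢j)
      (~-irrefl (trans (sym (vertex∘g i)) (trans (cong vertex eq) (vertex∘g j))))

    inImage? : ∀ v → Dec (∃[ i ] g i ≡ v)
    inImage? v = Fin.any? λ i → g i Fin.≟ v

    X : Subset order
    X = tabulate (does ∘ inImage?)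

    g∈X : ∀ i → g i ∈ X
    g∈X i = lookup⇒[]= (g i) X
      (trans (lookup∘tabulate _ (g i)) (dec-true (inImage? (g i)) (i , refl)))

    ∈X⇒inImage : ∀ {v} → v ∈ X → ∃[ i ] g i ≡ v
    ∈X⇒inImage {v} v∈X with inImage? v | trans (sym (lookup∘tabulate (does ∘ inImage?) v)) ([]=⇒lookup v∈X)
    ... | yes h | _  = h
    ... | no  _ | ()

    clique : IsClique G X
    clique v v′ v∈X v′∈X v≢v′ with ∈X⇒inImage v∈X | ∈X⇒inImage v′∈X
    ... | i , refl | j , refl rewrite vertex∘g i | vertex∘g j =
      adjacent i j (v≢v′ ∘ cong g)

-- The order of a primitive element.

module _ {n} (F : FiniteField n) where
  open FiniteField F using (Carrier; enum; invertible; commutativeRing; 0#; 1#)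
    renaming (_+_ to _⊕_; _*_ to _⊗_; _^_ to _↑_)
  open CommutativeRing commutativeRing using (*-assoc; *-comm; *-identityˡ; *-identityʳ; commutativeSemiring)
  open Exp commutativeSemiring using (^-homo-*; ^-assocʳ)

  ⊗-cancelˡ : ∀ {x y z} → x ≢ 0# → x ⊗ y ≡ x ⊗ z → y ≡ z
  ⊗-cancelˡ {x} {y} {z} x≢0 xy≡xz with x⁻¹ , xx⁻¹≡1 ← invertible x x≢0 =
    trans (sym (undo y)) (trans (cong (x⁻¹ ⊗_) xy≡xz) (undo z))
    where
    undo : ∀ v → x⁻¹ ⊗ (x ⊗ v) ≡ v
    undo v = begin
      x⁻¹ ⊗ (x ⊗ v)   ≡⟨ *-assoc x⁻¹ x v ⟨
      x⁻¹ ⊗ x ⊗ v     ≡⟨ cong (_⊗ v) (trans (*-comm x⁻¹ x) xx⁻¹≡1) ⟩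
      1# ⊗ v          ≡⟨ *-identityˡ v ⟩
      v               ∎
      where open ≡-Reasoning

  1↑k≡1 : ∀ k → 1# ↑ k ≡ 1#
  1↑k≡1 zero    = refl
  1↑k≡1 (suc k) = trans (*-identityˡ _) (1↑k≡1 k)

  x↑d≡1⇒x↑k≡x↑k%d : ∀ {x} d .{{_ : NonZero d}} → x ↑ d ≡ 1# → ∀ k → x ↑ k ≡ x ↑ (k % d)
  x↑d≡1⇒x↑k≡x↑k%d {x} d x↑d≡1 k = begin
    x ↑ k                              ≡⟨ cong (x ↑_) (m≡m%n+[m/n]*n k d) ⟩
    x ↑ (k % d + k / d * d)            ≡⟨ ^-homo-* x (k % d) (k / d * d) ⟩
    x ↑ (k % d) ⊗ x ↑ (k / d * d)      ≡⟨ cong (λ e → x ↑ (k % d) ⊗ x ↑ e) (ℕ.*-comm (k / d) d) ⟩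
    x ↑ (k % d) ⊗ x ↑ (d * (k / d))    ≡⟨ cong (x ↑ (k % d) ⊗_) (^-assocʳ x d (k / d)) ⟨
    x ↑ (k % d) ⊗ (x ↑ d) ↑ (k / d)    ≡⟨ cong (λ y → x ↑ (k % d) ⊗ y ↑ (k / d)) x↑d≡1 ⟩
    x ↑ (k % d) ⊗ 1# ↑ (k / d)         ≡⟨ cong (x ↑ (k % d) ⊗_) (1↑k≡1 (k / d)) ⟩
    x ↑ (k % d) ⊗ 1#                   ≡⟨ *-identityʳ _ ⟩
    x ↑ (k % d)                        ∎
    where open ≡-Reasoning

  module _ {w} (w-primitive : IsPrimitive F w) where
    open IsPrimitive w-primitive

    -- Serves two counting arguments: if w^d = 1, the case `k = d` covers the field, while `k = n`
    -- has more indices than the field has elements.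
    zeroOrPower : ∀ {k} → Fin (suc k) → Carrier
    zeroOrPower zero    = 0#
    zeroOrPower (suc i) = w ↑ toℕ i

    zeroOrPower-surjective : ∀ d .{{_ : NonZero d}} → w ↑ d ≡ 1# → ∀ x → ∃[ i ] zeroOrPower {d} i ≡ x
    zeroOrPower-surjective d w↑d≡1 x with FiniteField._≟_ F x 0#
    ... | yes x≡0 = zero , sym x≡0
    ... | no  x≢0 with k , x≡w↑k ← generate x x≢0 = suc (fromℕ< (m%n<n k d)) ,
      trans (cong (w ↑_) (Fin.toℕ-fromℕ< (m%n<n k d)))
        (sym (trans x≡w↑k (x↑d≡1⇒x↑k≡x↑k%d d w↑d≡1 k)))

    -- Zero and the powers below `d` exhaust the field, so choosing an index for each element is an
    -- injection into `Fin (suc d)`.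
    w↑d≡1⇒n≤1+d : ∀ d .{{_ : NonZero d}} → w ↑ d ≡ 1# → n ≤ suc d
    w↑d≡1⇒n≤1+d d w↑d≡1 = Fin.injective⇒≤ {f = index} λ {i} {j} eq → begin
      i                                    ≡⟨ Inverse.strictlyInverseˡ enum i ⟨
      Inverse.to enum (Inverse.from enum i) ≡⟨ cong (Inverse.to enum) (index-injective i j eq) ⟩
      Inverse.to enum (Inverse.from enum j) ≡⟨ Inverse.strictlyInverseˡ enum j ⟩
      j                                    ∎
      where
      open ≡-Reasoning
      preimage = λ i → zeroOrPower-surjective d w↑d≡1 (Inverse.from enum i)
      index : Fin n → Fin (suc d)
      index i = proj₁ (preimage i)
      index-injective : ∀ i j → index i ≡ index j → Inverse.from enum i ≡ Inverse.from enum j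
      index-injective i j eq =
        trans (sym (proj₂ (preimage i))) (trans (cong zeroOrPower eq) (proj₂ (preimage j)))

    w↑i≡w↑j⇒w↑[j∸i]≡1 : ∀ {i j} → i ≤ j → w ↑ i ≡ w ↑ j → w ↑ (j ∸ i) ≡ 1#
    w↑i≡w↑j⇒w↑[j∸i]≡1 {i} {j} i≤j eq = ⊗-cancelˡ (^-nonZero F nonZero i) (begin
      w ↑ i ⊗ w ↑ (j ∸ i)   ≡⟨ ^-homo-* w i (j ∸ i) ⟨
      w ↑ (i + (j ∸ i))     ≡⟨ cong (w ↑_) (ℕ.m+[n∸m]≡n i≤j) ⟩
      w ↑ j                 ≡⟨ eq ⟨
      w ↑ i                 ≡⟨ *-identityʳ _ ⟨
      w ↑ i ⊗ 1#            ∎)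
      where open ≡-Reasoning

    -- Two of the n + 1 terms 0, w^0, ..., w^(n-1) coincide, and neither is 0. The difference d of
    -- their exponents satisfies 0 < d ≤ n - 1 and w^d = 1, and the preceding count gives d ≥ n - 1.
    w↑[n∸1]≡1 : w ↑ (n ∸ 1) ≡ 1#
    w↑[n∸1]≡1 with Fin.pigeonhole (ℕ.n<1+n n) (Inverse.to enum ∘ zeroOrPower)
    ... | i , j , i<j , eq = collision i j i<j (begin
      zeroOrPower i                                         ≡⟨ Inverse.strictlyInverseʳ enum _ ⟨
      Inverse.from enum (Inverse.to enum (zeroOrPower i))   ≡⟨ cong (Inverse.from enum) eq ⟩
      Inverse.from enum (Inverse.to enum (zeroOrPower j))   ≡⟨ Inverse.strictlyInverseʳ enum _ ⟩
      zeroOrPower j                                         ∎)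
      where
      open ≡-Reasoning
      collision : ∀ (i j : Fin (suc n)) → toℕ i < toℕ j → zeroOrPower i ≡ zeroOrPower j →
                  w ↑ (n ∸ 1) ≡ 1#
      collision zero    (suc j) _         eq = contradiction (sym eq) (^-nonZero F nonZero (toℕ j))
      collision (suc i) (suc j) (s≤s i<j) eq = subst (λ d → w ↑ d ≡ 1#)
        (ℕ.≤-antisym
          (ℕ.≤-trans (ℕ.m∸n≤m (toℕ j) (toℕ i)) (ℕ.∸-monoˡ-≤ 1 (Fin.toℕ<n j)))
          (ℕ.∸-monoˡ-≤ 1 (w↑d≡1⇒n≤1+d (toℕ j ∸ toℕ i) {{>-nonZero (ℕ.m<n⇒0<n∸m i<j)}} w↑d≡1)))
        w↑d≡1
        where w↑d≡1 = w↑i≡w↑j⇒w↑[j∸i]≡1 (ℕ.<⇒≤ i<j) eq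

    w↑d≡1∧d<n∸1⇒d≡0 : ∀ d → w ↑ d ≡ 1# → d < n ∸ 1 → d ≡ 0
    w↑d≡1∧d<n∸1⇒d≡0 zero    _     _   = refl
    w↑d≡1∧d<n∸1⇒d≡0 (suc d) w↑d≡1 d<n =
      contradiction (ℕ.∸-monoˡ-≤ 1 (w↑d≡1⇒n≤1+d (suc d) w↑d≡1)) (ℕ.<⇒≱ d<n)

    -- The remainder of `k` modulo n - 1 is also an exponent giving 1, and it is too small to be
    -- positive.
    w↑k≡1⇒n∸1∣k : .{{_ : NonZero (n ∸ 1)}} → ∀ k → w ↑ k ≡ 1# → n ∸ 1 ∣ k
    w↑k≡1⇒n∸1∣k k w↑k≡1 = m%n≡0⇒n∣m k (n ∸ 1) (w↑d≡1∧d<n∸1⇒d≡0 _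
      (trans (sym (x↑d≡1⇒x↑k≡x↑k%d (n ∸ 1) w↑[n∸1]≡1 k)) w↑k≡1) (m%n<n k (n ∸ 1)))

    private
      ↑-injective-≤ : ∀ {i j} → i ≤ j → j < n ∸ 1 → w ↑ i ≡ w ↑ j → i ≡ j
      ↑-injective-≤ {i} {j} i≤j j<n eq = ℕ.≤-antisym i≤j (ℕ.m∸n≡0⇒m≤n
        (w↑d≡1∧d<n∸1⇒d≡0 (j ∸ i) (w↑i≡w↑j⇒w↑[j∸i]≡1 i≤j eq)
          (ℕ.≤-<-trans (ℕ.m∸n≤m j i) j<n)))

    ↑-injective : ∀ {i j} → i < n ∸ 1 → j < n ∸ 1 → w ↑ i ≡ w ↑ j → i ≡ j
    ↑-injective {i} {j} i<n j<n eq with ℕ.≤-total i j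
    ... | inj₁ i≤j = ↑-injective-≤ i≤j j<n eq
    ... | inj₂ j≤i = sym (↑-injective-≤ j≤i i<n (sym eq))

    -- Provides exponents in the form that adjacency in `Γ` asks for, as elements of `Fin (n ∸ 1)`.
    logarithm : .{{_ : NonZero (n ∸ 1)}} → ∀ x → x ≢ 0# → ∃[ i ] x ≡ w ↑ toℕ {n ∸ 1} i
    logarithm x x≢0 with zeroOrPower-surjective (n ∸ 1) w↑[n∸1]≡1 x
    ... | zero  , eq = contradiction (sym eq) x≢0
    ... | suc i , eq = i , sym eq

-- Frobenius maps and subfields in characteristic 2.

module _ {a} (F : FiniteField (2 ^ a)) where
  open FiniteField F using (Carrier; commutativeRing; 0#; 1#)
    renaming (_+_ to _⊕_; _*_ to _⊗_; _^_ to _↑_)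
  open CommutativeRing commutativeRing
    using (+-assoc; +-identityˡ; +-identityʳ; *-identityʳ; zeroˡ; commutativeSemiring)
  open Exp commutativeSemiring using (^-assocʳ)

  ⊕-↑2 : ∀ x y → (x ⊕ y) ↑ 2 ≡ x ↑ 2 ⊕ y ↑ 2
  ⊕-↑2 x y = begin
    (x ⊕ y) ↑ 2                           ≡⟨ binomial x y ⟩
    (x ↑ 2 ⊕ y ↑ 2) ⊕ (x ⊗ y ⊕ x ⊗ y)     ≡⟨ cong ((x ↑ 2 ⊕ y ↑ 2) ⊕_) (x+x≡0 {a} F (x ⊗ y)) ⟩
    (x ↑ 2 ⊕ y ↑ 2) ⊕ 0#                  ≡⟨ +-identityʳ _ ⟩
    x ↑ 2 ⊕ y ↑ 2                         ∎
    where
    open ≡-Reasoning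
    open NaturalCoefficients commutativeSemiring using (solve; _:+_; _:*_; _:^_; _:=_)
    binomial : ∀ x y → (x ⊕ y) ↑ 2 ≡ (x ↑ 2 ⊕ y ↑ 2) ⊕ (x ⊗ y ⊕ x ⊗ y)
    binomial = solve 2 (λ x y → (x :+ y) :^ 2 := (x :^ 2 :+ y :^ 2) :+ (x :* y :+ x :* y)) refl

  -- Squaring is additive because the doubled cross term vanishes; this is iterated `m` times.
  frobenius-⊕ : ∀ m x y → (x ⊕ y) ↑ (2 ^ m) ≡ x ↑ (2 ^ m) ⊕ y ↑ (2 ^ m)
  frobenius-⊕ zero    x y = trans (*-identityʳ _) (sym (cong₂ _⊕_ (*-identityʳ x) (*-identityʳ y)))
  frobenius-⊕ (suc m) x y = begin
    (x ⊕ y) ↑ (2 * 2 ^ m)                   ≡⟨ ^-assocʳ (x ⊕ y) 2 (2 ^ m) ⟨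
    ((x ⊕ y) ↑ 2) ↑ (2 ^ m)                 ≡⟨ cong (_↑ (2 ^ m)) (⊕-↑2 x y) ⟩
    (x ↑ 2 ⊕ y ↑ 2) ↑ (2 ^ m)               ≡⟨ frobenius-⊕ m (x ↑ 2) (y ↑ 2) ⟩
    (x ↑ 2) ↑ (2 ^ m) ⊕ (y ↑ 2) ↑ (2 ^ m)   ≡⟨ cong₂ _⊕_ (^-assocʳ x 2 (2 ^ m)) (^-assocʳ y 2 (2 ^ m)) ⟩
    x ↑ (2 * 2 ^ m) ⊕ y ↑ (2 * 2 ^ m)       ∎
    where open ≡-Reasoning

  x⊕y⊕y≡x : ∀ x y → x ⊕ y ⊕ y ≡ x
  x⊕y⊕y≡x x y = trans (+-assoc x y y) (trans (cong (x ⊕_) (x+x≡0 {a} F y)) (+-identityʳ x))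

  x≢y⇒x⊕y≢0 : ∀ {x y} → x ≢ y → x ⊕ y ≢ 0#
  x≢y⇒x⊕y≢0 {x} {y} x≢y eq =
    x≢y (trans (sym (x⊕y⊕y≡x x y)) (trans (cong (_⊕ y) eq) (+-identityˡ y)))

  module _ {w} (w-primitive : IsPrimitive F w) .{{_ : NonZero a}} m .{{_ : NonZero m}} {M}
           (order≡ : 2 ^ a ∸ 1 ≡ M * (2 ^ m ∸ 1)) where
    private
      N = 2 ^ m ∸ 1
      instance
        order-nonZero : NonZero (2 ^ a ∸ 1)
        order-nonZero = 2^n∸1-nonZero a
        N-nonZero : NonZero N
        N-nonZero = 2^n∸1-nonZero m
        M-nonZero : NonZero M
        M-nonZero = ℕ.m*n≢0⇒m≢0 M {{subst NonZero order≡ order-nonZero}}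

    -- An enumeration of GF(2^m): since `w` has order M * N, the element w^M generates the
    -- multiplicative subgroup of order N.
    subfield : Fin (suc N) → Carrier
    subfield zero    = 0#
    subfield (suc j) = w ↑ (M * toℕ j)

    M*j<2^a∸1 : ∀ (j : Fin N) → M * toℕ j < 2 ^ a ∸ 1
    M*j<2^a∸1 j = subst (M * toℕ j <_) (sym order≡) (ℕ.*-monoʳ-< M (Fin.toℕ<n j))

    subfield-injective : Injective _≡_ _≡_ subfield
    subfield-injective {zero}  {zero}  eq = refl
    subfield-injective {zero}  {suc j} eq = contradiction (sym eq) (^-nonZero F (IsPrimitive.nonZero w-primitive) (M * toℕ j))
    subfield-injective {suc i} {zero}  eq = contradiction eq (^-nonZero F (IsPrimitive.nonZero w-primitive) (M * toℕ i))
    subfield-injective {suc i} {suc j} eq = cong suc (Fin.toℕ-injective (ℕ.*-cancelˡ-≡ _ _ M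
      (↑-injective F w-primitive (M*j<2^a∸1 i) (M*j<2^a∸1 j) eq)))

    -- For a non-zero element, the N-th power is a power of w^(M * N) = w^(2^a - 1) = 1.
    subfield-↑ : ∀ i → subfield i ↑ (2 ^ m) ≡ subfield i
    subfield-↑ i = trans (cong (subfield i ↑_) (sym (suc[2^n∸1]≡2^n m))) (fixed i)
      where
      open ≡-Reasoning
      fixed : ∀ i → subfield i ↑ suc N ≡ subfield i
      fixed zero    = zeroˡ _
      fixed (suc j) = begin
        x ⊗ x ↑ N                       ≡⟨ cong (x ⊗_) (^-assocʳ w (M * toℕ j) N) ⟩
        x ⊗ w ↑ (M * toℕ j * N)         ≡⟨ cong (λ e → x ⊗ w ↑ e) exponent ⟩
        x ⊗ w ↑ ((2 ^ a ∸ 1) * toℕ j)   ≡⟨ cong (x ⊗_) (^-assocʳ w (2 ^ a ∸ 1) (toℕ j)) ⟨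
        x ⊗ (w ↑ (2 ^ a ∸ 1)) ↑ toℕ j   ≡⟨ cong (λ y → x ⊗ y ↑ toℕ j) (w↑[n∸1]≡1 F w-primitive) ⟩
        x ⊗ 1# ↑ toℕ j                  ≡⟨ cong (x ⊗_) (1↑k≡1 F (toℕ j)) ⟩
        x ⊗ 1#                          ≡⟨ *-identityʳ x ⟩
        x                               ∎
        where
        x = subfield (suc j)
        swap : ∀ M j N → M * j * N ≡ M * N * j
        swap = solve-∀
        exponent : M * toℕ j * N ≡ (2 ^ a ∸ 1) * toℕ j
        exponent = trans (swap M (toℕ j) N) (cong (_* toℕ j) (sym order≡))

    -- Cancelling `x` gives x^N = 1. For x = w^i the order M * N of `w` then divides i * N, hence M
    -- divides i.
    x↑2^m≡x⇒power : ∀ {x} → x ≢ 0# → x ↑ (2 ^ m) ≡ x →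
      ∃[ i ] M ∣ toℕ i × x ≡ w ↑ toℕ {2 ^ a ∸ 1} i
    x↑2^m≡x⇒power {x} x≢0 fixed with i , x≡w↑i ← logarithm F w-primitive x x≢0 =
      i , *-cancelʳ-∣ N (subst (_∣ toℕ i * N) order≡ (w↑k≡1⇒n∸1∣k F w-primitive _ (begin
        w ↑ (toℕ i * N)   ≡⟨ ^-assocʳ w (toℕ i) N ⟨
        (w ↑ toℕ i) ↑ N   ≡⟨ cong (_↑ N) x≡w↑i ⟨
        x ↑ N             ≡⟨ ⊗-cancelˡ F x≢0 (begin
          x ⊗ x ↑ N       ≡⟨ cong (x ↑_) (suc[2^n∸1]≡2^n m) ⟩
          x ↑ (2 ^ m)     ≡⟨ fixed ⟩
          x               ≡⟨ *-identityʳ x ⟨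
          x ⊗ 1#          ∎) ⟩
        1#                ∎))) , x≡w↑i
      where open ≡-Reasoning

    -- The fixed points of an additive map are closed under addition, which in characteristic 2 is
    -- also subtraction; so the sum is a non-zero fixed point of the Frobenius map x ↦ x^(2^m).
    subfield-difference : ∀ {i j} → i ≢ j →
      ∃[ k ] M ∣ toℕ k × subfield i ⊕ subfield j ≡ w ↑ toℕ {2 ^ a ∸ 1} k
    subfield-difference {i} {j} i≢j = x↑2^m≡x⇒power (x≢y⇒x⊕y≢0 (i≢j ∘ subfield-injective))
      (trans (frobenius-⊕ m (subfield i) (subfield j)) (cong₂ _⊕_ (subfield-↑ i) (subfield-↑ j)))

-- Halving modulo p.

module _ (p : ℕ) .{{_ : NonZero p}} where
  private
    module Z = ℤmod p

  p∣k⇒fromℕ≡0 : ∀ {k} → p ∣ k → Z.fromℕ k ≡ Z.0#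
  p∣k⇒fromℕ≡0 {k} p∣k = Fin.toℕ-injective (begin
    toℕ (Z.fromℕ k)   ≡⟨ Fin.toℕ-fromℕ< _ ⟩
    k % p             ≡⟨ n∣m⇒m%n≡0 k p p∣k ⟩
    0                 ≡⟨ n∣m⇒m%n≡0 0 p (p ∣0) ⟨
    0 % p             ≡⟨ Fin.toℕ-fromℕ< _ ⟨
    toℕ Z.0#          ∎)
    where open ≡-Reasoning

  fromℕ-toℕ : ∀ r → Z.fromℕ (toℕ r) ≡ r
  fromℕ-toℕ r = Fin.toℕ-injective (trans (Fin.toℕ-fromℕ< _) (m<n⇒m%n≡m (Fin.toℕ<n r)))

  -- For m ≥ 1 the number 2^m + 1 is odd, so 2 is invertible modulo its divisor `p`.
  half : ∀ m .{{_ : NonZero m}} → p ∣ 2 ^ m + 1 → ∀ u → ∃[ t ] t Z.+ t ≡ u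
  half (suc m) p∣ u = t , (begin
    t Z.+ t                                                ≡⟨ Z.fromℕ-homo-+ (h * toℕ u) (h * toℕ u) ⟩
    Z.fromℕ (h * toℕ u + h * toℕ u)                        ≡⟨ cong Z.fromℕ (double (2 ^ m) (toℕ u)) ⟩
    Z.fromℕ (toℕ u + toℕ u * (2 ^ suc m + 1))              ≡⟨ Z.fromℕ-homo-+ (toℕ u) _ ⟨
    Z.fromℕ (toℕ u) Z.+ Z.fromℕ (toℕ u * (2 ^ suc m + 1))  ≡⟨ cong₂ Z._+_ (fromℕ-toℕ u) (p∣k⇒fromℕ≡0 (∣n⇒∣m*n (toℕ u) p∣)) ⟩
    u Z.+ Z.0#                                             ≡⟨ AbelianGroup.identityʳ Z.+-0-abelianGroup u ⟩
    u                                                      ∎)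
    where
    open ≡-Reasoning
    -- The inverse of 2 modulo 2^(m+1) + 1.
    h = 2 ^ m + 1
    t = Z.fromℕ (h * toℕ u)
    double : ∀ b u → (b + 1) * u + (b + 1) * u ≡ u + u * (2 * b + 1)
    double = solve-∀

-- The subfield clique and the bound on ω.

module _ {a p} .{{_ : NonZero p}} (F : FiniteField (2 ^ a))
         {w} (w-primitive : IsPrimitive F w) (S U : Subset p)
         (S-symmetric : ∀ x → x ∈ S ⇔ ℤmod.-_ p x ∈ S) (0∉S : ℤmod.0# p ∉ S) where

  subfieldClique : .{{_ : NonZero a}} → ∀ m .{{_ : NonZero m}} {M} →
    2 ^ a ∸ 1 ≡ M * (2 ^ m ∸ 1) → p ∣ M → p ∣ 2 ^ m + 1 → Nonempty U →
    2 ^ m + 1 ≤ ω (Γ a p F w-primitive S U S-symmetric 0∉S)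
  subfieldClique m order≡ p∣M p∣2^m+1 (u , u∈U) with t , t+t≡u ← half p m p∣2^m+1 u =
    subst (_≤ ω G) (trans (cong suc (suc[2^n∸1]≡2^n m)) (ℕ.+-comm 1 (2 ^ m)))
      (pairwiseAdjacent⇒≤ω G f adjacent)
    where
    G = Γ a p F w-primitive S U S-symmetric 0∉S
    open Graph G using (_~_)
    open ℤmod p using (_-_; -_; fromℕ; +-0-abelianGroup) renaming (_+_ to _∔_; 0# to 0ₚ)
    open AbelianGroup +-0-abelianGroup using (identityʳ)
    open AbelianGroupProperties +-0-abelianGroup using (//-rightDividesˡ; \\-leftDividesʳ)
    open FiniteField F using () renaming (_+_ to _⊕_; _^_ to _↑_)
    open CommutativeRing (FiniteField.commutativeRing F) using (+-comm)
    open ≡-Reasoning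

    x : Fin (suc (2 ^ m ∸ 1)) → FiniteField.Carrier F
    x = subfield {a} F w-primitive m order≡

    f : Fin (suc (suc (2 ^ m ∸ 1))) → MSVertex a p F
    -- A vertex at infinity is joined by `u` to every field vertex whose second coordinate is larger
    -- by `u`; this choice makes that coordinate `t`.
    f zero    = ∞ , t - u
    f (suc i) = fin (x i) , t

    adjacent : ∀ i j → i ≢ j → f i ~ f j
    adjacent zero    zero    i≢j = contradiction refl i≢j
    adjacent zero    (suc j) i≢j = inj₂ (x j , u , u∈U , cong (fin (x j) ,_) (sym (//-rightDividesˡ u t)))
    adjacent (suc i) zero    i≢j = inj₂ (inj₁ (u , u∈U , refl))
    adjacent (suc i) (suc j) i≢j
      -- The edge uses the exponent `k` of the difference of the two field elements. It moves the
      -- second coordinate `t` to -t + u + 2k, which is again `t` because p ∣ M ∣ k and 2t = u.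
      with k , M∣k , eq ← subfield-difference {a} F w-primitive m order≡ (i≢j ∘ cong suc) =
      inj₂ (inj₂ (k , u , u∈U , cong₂ (λ y r → fin y , r)
        (begin
          x j                  ≡⟨ x⊕y⊕y≡x {a} F (x j) (x i) ⟨
          x j ⊕ x i ⊕ x i      ≡⟨ cong (_⊕ x i) (trans (+-comm (x j) (x i)) eq) ⟩
          w ↑ toℕ k ⊕ x i      ≡⟨ +-comm _ _ ⟩
          x i ⊕ w ↑ toℕ k      ∎)
        (begin
          t                                   ≡⟨ \\-leftDividesʳ t t ⟨
          - t ∔ (t ∔ t)                       ≡⟨ cong (- t ∔_) t+t≡u ⟩
          - t ∔ u                             ≡⟨ identityʳ _ ⟨
          - t ∔ u ∔ 0ₚ                        ≡⟨ cong (- t ∔ u ∔_) (p∣k⇒fromℕ≡0 p (∣n⇒∣m*n 2 (∣-trans p∣M M∣k))) ⟨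
          - t ∔ u ∔ fromℕ (2 * toℕ k)         ∎)))

theorem5p6 : ∀ (s : ℕ) → s ≥ 1 →
    let a = 2 ^ s in
    FermatPrime (2 ^ a + 1) →
    ∀ (p : ℕ) .{{_ : NonZero p}} → Prime p → p ∣ 2 ^ a ∸ 1 →
    ∀ (F : FiniteField (2 ^ a)) (w : FiniteField.Carrier F) (w-primitive : IsPrimitive F w)
    (S U : Subset p)
    (S-symmetric : ∀ x → x ∈ S ⇔ ℤmod.-_ p x ∈ S) (0∉S : ℤmod.0# p ∉ S) →
    Nonempty U →
    let ω[Γ] = ω (Γ a p F w-primitive S U S-symmetric 0∉S) in
    ω[Γ] ≥ p × (ω[Γ] ≡ p → ∃[ l ] l ≤ s ∸ 1 × p ≡ 2 ^ (2 ^ l) + 1)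
theorem5p6 s _ _ p p-prime p∣2^a∸1 F w w-primitive S U S-symmetric 0∉S U-nonempty
  with l , M , l<s , p∣Fₗ , p∣M , order≡ ← prime∣2^[2^s]∸1 p-prime s p∣2^a∸1 =
  -- Everything follows from p ≤ 2^(2^l) + 1 ≤ ω: if ω = p, the Fermat number in the middle is
  -- squeezed to equal `p`.
  ℕ.≤-trans p≤Fₗ Fₗ≤ω , λ ω≡p →
    l , ℕ.<⇒≤pred l<s , ℕ.≤-antisym p≤Fₗ (subst (2 ^ (2 ^ l) + 1 ≤_) ω≡p Fₗ≤ω)
  where
  p≤Fₗ : p ≤ 2 ^ (2 ^ l) + 1
  p≤Fₗ = ∣⇒≤ {{>-nonZero (ℕ.m≤n+m 1 (2 ^ (2 ^ l)))}} p∣Fₗ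
  Fₗ≤ω = subfieldClique F w-primitive S U S-symmetric 0∉S {{ℕ.m^n≢0 2 s}}
    (2 ^ l) {{ℕ.m^n≢0 2 l}} order≡ p∣M p∣Fₗ U-nonempty
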